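{- Let $G$ be a connected undirected graph on $N\ge 2$ nodes with positive link weights, and let $\mathcal{S}$ be its (original) simplex in $\mathbb{R}^{N-1}$. For every non-empty proper subset $\mathcal{V}$ of $\mathcal{N}=\{1,\dots,N\}$ with $V$ elements and complement $\bar{\mathcal{V}}=\mathcal{N}\setminus\mathcal{V}$, $$\Vert c_{\mathcal{V}}\Vert^2=\frac{\vert\partial\mathcal{V}\vert}{V^2}\qquad\text{and}\qquad \Vert c_{\bar{\mathcal{V}}}\Vert^2=\frac{\vert\partial\bar{\mathcal{V}}\vert}{(N-V)^2}.$$
   Context: The graph $G$ has node set $\mathcal{N}=\{1,\dots,N\}$, link set $\mathcal{L}$ (links join distinct nodes) and weights $w_{ij}=w_{ji}>0$ for $(i,j)\in\mathcal{L}$ (all equal to $1$ in the unweighted case). The Laplacian $Q$ is the $N\times N$ symmetric matrix with $(Q)_{ii}=d_i$, the sum of the weights of links incident to $i$, $(Q)_{ij}=-w_{ij}$ if $(i,j)\in\mathcal{L}$, and $(Q)_{ij}=0$ otherwise. Since $G$ is connected, $Q$ has eigenvalues $\mu_1\ge\dots\ge\mu_{N-1}>\mu_N=0$ with orthonormal eigenvectors $z_1,\dots,z_N$. The simplex $\mathcal{S}$ of $G$ is the convex hull of the vertices $s_1,\dots,s_N\in\mathbb{R}^{N-1}$ with $(s_i)_k=(z_k)_i\sqrt{\mu_k}$ for $k=1,\dots,N-1$ (so $s_i^Ts_j=(Q)_{ij}$). For non-empty $\mathcal{V}\subset\mathcal{N}$ with $V$ elements, $c_{\mathcal{V}}=\frac1V\sum_{i\in\mathcal{V}}s_i$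 is the centroid of the face with vertices $\{s_i\}_{i\in\mathcal{V}}$. The cut size $\vert\partial\mathcal{V}\vert$ is the total weight (number, in the unweighted case) of links with one endpoint in $\mathcal{V}$ and the other in $\mathcal{N}\setminus\mathcal{V}$. -}

module Defs where

open import Algebra.Bundles.Raw using (RawMonoid)
import Algebra.Definitions.RawMonoid as RawMonoidDefs
open import Algebra.Properties.CommutativeSemigroup using (interchange)
open import Algebra.Bundles using (CommutativeMonoid)
open import Data.Bool.Base using (if_then_else_)
open import Data.Fin.Base as Fin using (Fin; inject₁)
open import Data.Fin.Properties using (_≟_)
open import Data.Fin.Subset using (Subset; Nonempty; _⊂_; ⊤; ∁; ∣_∣)
open import Data.Fin.Subset.Properties
  using (_∈?_; p⊂q⇒∣p∣<∣q∣; ∣⊤∣≡n; x∉p⇒x∈∁p; x∈p⇒∣p-x∣<∣p∣)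
open import Data.Integer.Base using (+_)
open import Data.Nat.Base as ℕ using (ℕ; suc; NonZero)
import Data.Nat.Properties as ℕ
open import Data.Product.Base using (∃; _×_; _,_)
open import Data.Rational.Base as ℚ using (ℚ; 0ℚ; 1ℚ; ½)
import Data.Rational.Properties as ℚ
open import Data.Vec.Functional using (Vector)
open import Level using (0ℓ)
open import Relation.Binary.Construct.Closure.ReflexiveTransitive using (Star)
open import Relation.Binary.Core using (Rel)
open import Relation.Binary.Definitions using (Decidable; Symmetric; Irreflexive)
open import Relation.Binary.PropositionalEquality
  using (_≡_; refl; sym; trans; cong; cong₂; subst; subst₂)
open import Relation.Nullary.Decidable.Core using (does)

------------------------------------------------------------------------
-- The real numbers, by Cantor's construction: Cauchy sequences of
-- rationals, two of them being equal when their difference tends to 0.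

Eventually : (ℕ → Set) → Set
Eventually P = ∃ λ m₀ → ∀ m → m₀ ℕ.≤ m → P m

IsCauchy : (ℕ → ℚ) → Set
IsCauchy x = ∀ ε → 0ℚ ℚ.< ε →
  ∃ λ m₀ → ∀ m n → m₀ ℕ.≤ m → m₀ ℕ.≤ n → ℚ.∣ x m ℚ.- x n ∣ ℚ.< ε

record ℝ : Set where
  constructor mkℝ
  field
    seq    : ℕ → ℚ
    cauchy : IsCauchy seq

open ℝ public

infix 4 _≃_ _≤_ _<_

_≃_ : Rel ℝ 0ℓ
x ≃ y = ∀ ε → 0ℚ ℚ.< ε → Eventually λ m → ℚ.∣ seq x m ℚ.- seq y m ∣ ℚ.< ε

_≤_ : Rel ℝ 0ℓ
x ≤ y = ∀ ε → 0ℚ ℚ.< ε → Eventually λ m → seq x m ℚ.< seq y m ℚ.+ ε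

_<_ : Rel ℝ 0ℓ
x < y = ∃ λ ε → 0ℚ ℚ.< ε × Eventually λ m → seq x m ℚ.+ ε ℚ.< seq y m

-- The proofs are abstract so that they are never unfolded when types
-- involving real arithmetic are normalised.
abstract

  telescope : ∀ p q r → (p ℚ.- q) ℚ.+ (q ℚ.- r) ≡ p ℚ.- r
  telescope p q r = trans (ℚ.+-assoc p (ℚ.- q) (q ℚ.- r)) (cong (p ℚ.+_)
    (trans (sym (ℚ.+-assoc (ℚ.- q) q (ℚ.- r)))
      (trans (cong (ℚ._- r) (ℚ.+-inverseˡ q)) (ℚ.+-identityˡ (ℚ.- r)))))

  +-difference : ∀ a b c d →
    (a ℚ.+ b) ℚ.- (c ℚ.+ d) ≡ (a ℚ.- c) ℚ.+ (b ℚ.- d)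
  +-difference a b c d = trans (cong (a ℚ.+ b ℚ.+_) (ℚ.neg-distrib-+ c d))
    (interchange (CommutativeMonoid.commutativeSemigroup ℚ.+-0-commutativeMonoid)
      a b (ℚ.- c) (ℚ.- d))

  *-difference : ∀ a b c d →
    a ℚ.* b ℚ.- c ℚ.* d ≡ a ℚ.* (b ℚ.- d) ℚ.+ d ℚ.* (a ℚ.- c)
  *-difference a b c d = sym (trans (cong₂ ℚ._+_ first second)
    (telescope (a ℚ.* b) (a ℚ.* d) (c ℚ.* d)))
    where
    first : a ℚ.* (b ℚ.- d) ≡ a ℚ.* b ℚ.- a ℚ.* d
    first = trans (ℚ.*-distribˡ-+ a b (ℚ.- d))
      (cong (a ℚ.* b ℚ.+_) (sym (ℚ.neg-distribʳ-* a d)))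
    second : d ℚ.* (a ℚ.- c) ≡ a ℚ.* d ℚ.- c ℚ.* d
    second = trans (ℚ.*-comm d (a ℚ.- c)) (trans (ℚ.*-distribʳ-+ d a (ℚ.- c))
      (cong (a ℚ.* d ℚ.+_) (sym (ℚ.neg-distribˡ-* c d))))

  half-pos : ∀ {ε} → 0ℚ ℚ.< ε → 0ℚ ℚ.< ½ ℚ.* ε
  half-pos {ε} 0<ε = subst (ℚ._< ½ ℚ.* ε) (ℚ.*-zeroʳ ½) (ℚ.*-monoʳ-<-pos ½ 0<ε)

  half+half : ∀ ε → ½ ℚ.* ε ℚ.+ ½ ℚ.* ε ≡ ε
  half+half ε = trans (sym (ℚ.*-distribʳ-+ ε ½ ½)) (ℚ.*-identityˡ ε)

  triangle : ∀ {ε p q r} → r ≡ p ℚ.+ q →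
             ℚ.∣ p ∣ ℚ.< ½ ℚ.* ε → ℚ.∣ q ∣ ℚ.< ½ ℚ.* ε → ℚ.∣ r ∣ ℚ.< ε
  triangle {ε} {p} {q} refl p< q< = ℚ.≤-<-trans (ℚ.∣p+q∣≤∣p∣+∣q∣ p q)
    (subst (ℚ.∣ p ∣ ℚ.+ ℚ.∣ q ∣ ℚ.<_) (half+half ε) (ℚ.+-mono-< p< q<))

  ∣p∣+1-pos : ∀ p → 0ℚ ℚ.< ℚ.∣ p ∣ ℚ.+ 1ℚ
  ∣p∣+1-pos p = ℚ.+-mono-≤-< (ℚ.0≤∣p∣ p) (ℚ.positive⁻¹ 1ℚ)

  -- Cauchy sequences are eventually bounded.
  bounded : ∀ x → ∃ λ b → 0ℚ ℚ.< b × Eventually λ m → ℚ.∣ seq x m ∣ ℚ.≤ b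
  bounded x with cauchy x 1ℚ (ℚ.positive⁻¹ 1ℚ)
  ... | m₀ , close = b , ∣p∣+1-pos (seq x m₀) , m₀ , bound
    where
    b : ℚ
    b = ℚ.∣ seq x m₀ ∣ ℚ.+ 1ℚ

    bound : ∀ m → m₀ ℕ.≤ m → ℚ.∣ seq x m ∣ ℚ.≤ b
    bound m m₀≤m = subst (λ p → ℚ.∣ p ∣ ℚ.≤ b)
      (trans (ℚ.+-comm (seq x m₀) (seq x m ℚ.- seq x m₀))
        (trans (ℚ.+-assoc (seq x m) (ℚ.- seq x m₀) (seq x m₀))
          (trans (cong (seq x m ℚ.+_) (ℚ.+-inverseˡ (seq x m₀)))
                 (ℚ.+-identityʳ (seq x m)))))
      (ℚ.≤-trans (ℚ.∣p+q∣≤∣p∣+∣q∣ (seq x m₀) (seq x m ℚ.- seq x m₀))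
        (ℚ.+-monoʳ-≤ ℚ.∣ seq x m₀ ∣ (ℚ.<⇒≤ (close m m₀ m₀≤m ℕ.≤-refl))))

  -- For every ε > 0 and b > 0 there is δ > 0 such that ∣ p ∣ ≤ b and
  -- ∣ q ∣ < δ imply ∣ p * q ∣ < ε.
  shrink : ∀ ε b → 0ℚ ℚ.< ε → 0ℚ ℚ.< b → ∃ λ δ → 0ℚ ℚ.< δ ×
           (∀ p q → ℚ.∣ p ∣ ℚ.≤ b → ℚ.∣ q ∣ ℚ.< δ → ℚ.∣ p ℚ.* q ∣ ℚ.< ε)
  shrink ε b 0<ε 0<b = δ , 0<δ , small
    where
    instance
      b-pos : ℚ.Positive b
      b-pos = ℚ.positive 0<b
      b-nonZero : ℚ.NonZero b
      b-nonZero = ℚ.pos⇒nonZero b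
      b-nonNeg : ℚ.NonNegative b
      b-nonNeg = ℚ.pos⇒nonNeg b
      1/b-pos : ℚ.Positive (ℚ.1/ b)
      1/b-pos = ℚ.1/pos⇒pos b

    δ : ℚ
    δ = ℚ.1/ b ℚ.* ε

    0<δ : 0ℚ ℚ.< δ
    0<δ = subst (ℚ._< δ) (ℚ.*-zeroʳ (ℚ.1/ b)) (ℚ.*-monoʳ-<-pos (ℚ.1/ b) 0<ε)

    bδ≡ε : b ℚ.* δ ≡ ε
    bδ≡ε = trans (sym (ℚ.*-assoc b (ℚ.1/ b) ε))
      (trans (cong (ℚ._* ε) (ℚ.*-inverseʳ b)) (ℚ.*-identityˡ ε))

    small : ∀ p q → ℚ.∣ p ∣ ℚ.≤ b → ℚ.∣ q ∣ ℚ.< δ → ℚ.∣ p ℚ.* q ∣ ℚ.< ε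
    small p q p≤b q<δ = subst₂ ℚ._<_ (sym (ℚ.∣p*q∣≡∣p∣*∣q∣ p q)) bδ≡ε
      (ℚ.≤-<-trans (ℚ.*-monoʳ-≤-nonNeg ℚ.∣ q ∣ {{ℚ.∣-∣-nonNeg q}} p≤b)
                   (ℚ.*-monoʳ-<-pos b q<δ))

  const-isCauchy : ∀ p → IsCauchy (λ _ → p)
  const-isCauchy p ε 0<ε = 0 , λ _ _ _ _ →
    subst (ℚ._< ε) (sym (cong ℚ.∣_∣ (ℚ.+-inverseʳ p))) 0<ε

  +-isCauchy : ∀ x y → IsCauchy (λ m → seq x m ℚ.+ seq y m)
  +-isCauchy x y ε 0<ε with cauchy x _ (half-pos 0<ε) | cauchy y _ (half-pos 0<ε)
  ... | m₁ , p | m₂ , q = m₁ ℕ.⊔ m₂ , λ m n m≥ n≥ → triangle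
    (+-difference (seq x m) (seq y m) (seq x n) (seq y n))
    (p m n (ℕ.m⊔n≤o⇒m≤o m₁ m₂ m≥) (ℕ.m⊔n≤o⇒m≤o m₁ m₂ n≥))
    (q m n (ℕ.m⊔n≤o⇒n≤o m₁ m₂ m≥) (ℕ.m⊔n≤o⇒n≤o m₁ m₂ n≥))

  neg-isCauchy : ∀ x → IsCauchy (λ m → ℚ.- seq x m)
  neg-isCauchy x ε 0<ε with cauchy x ε 0<ε
  ... | m₀ , p = m₀ , λ m n m≥ n≥ → subst (ℚ._< ε)
    (trans (sym (ℚ.∣-p∣≡∣p∣ (seq x m ℚ.- seq x n)))
      (cong ℚ.∣_∣ (ℚ.neg-distrib-+ (seq x m) (ℚ.- seq x n))))
    (p m n m≥ n≥)

  *-isCauchy : ∀ x y → IsCauchy (λ m → seq x m ℚ.* seq y m)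
  *-isCauchy x y ε 0<ε with bounded x | bounded y
  ... | b , 0<b , m₁ , x≤b | c , 0<c , m₂ , y≤c
    with shrink _ b (half-pos 0<ε) 0<b | shrink _ c (half-pos 0<ε) 0<c
  ... | δ , 0<δ , small | η , 0<η , small′
    with cauchy y δ 0<δ | cauchy x η 0<η
  ... | m₃ , p | m₄ , q = (m₁ ℕ.⊔ m₂) ℕ.⊔ (m₃ ℕ.⊔ m₄) , λ m n m≥ n≥ → triangle
    (*-difference (seq x m) (seq y m) (seq x n) (seq y n))
    (small (seq x m) (seq y m ℚ.- seq y n)
      (x≤b m (ℕ.m⊔n≤o⇒m≤o m₁ m₂ (left m≥)))
      (p m n (ℕ.m⊔n≤o⇒m≤o m₃ m₄ (right m≥)) (ℕ.m⊔n≤o⇒m≤o m₃ m₄ (right n≥))))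
    (small′ (seq y n) (seq x m ℚ.- seq x n)
      (y≤c n (ℕ.m⊔n≤o⇒n≤o m₁ m₂ (left n≥)))
      (q m n (ℕ.m⊔n≤o⇒n≤o m₃ m₄ (right m≥)) (ℕ.m⊔n≤o⇒n≤o m₃ m₄ (right n≥))))
    where
    left : ∀ {o} → (m₁ ℕ.⊔ m₂) ℕ.⊔ (m₃ ℕ.⊔ m₄) ℕ.≤ o → m₁ ℕ.⊔ m₂ ℕ.≤ o
    left = ℕ.m⊔n≤o⇒m≤o (m₁ ℕ.⊔ m₂) (m₃ ℕ.⊔ m₄)
    right : ∀ {o} → (m₁ ℕ.⊔ m₂) ℕ.⊔ (m₃ ℕ.⊔ m₄) ℕ.≤ o → m₃ ℕ.⊔ m₄ ℕ.≤ o
    right = ℕ.m⊔n≤o⇒n≤o (m₁ ℕ.⊔ m₂) (m₃ ℕ.⊔ m₄)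

fromℚ : ℚ → ℝ
fromℚ p = mkℝ (λ _ → p) (const-isCauchy p)

0ℝ 1ℝ : ℝ
0ℝ = fromℚ 0ℚ
1ℝ = fromℚ 1ℚ

infix  8 -_
infixl 7 _*_ _/ₙ_
infixl 6 _+_

_+_ : ℝ → ℝ → ℝ
x + y = mkℝ (λ m → seq x m ℚ.+ seq y m) (+-isCauchy x y)

-_ : ℝ → ℝ
- x = mkℝ (λ m → ℚ.- seq x m) (neg-isCauchy x)

_*_ : ℝ → ℝ → ℝ
x * y = mkℝ (λ m → seq x m ℚ.* seq y m) (*-isCauchy x y)

_/ₙ_ : ℝ → (m : ℕ) → .{{NonZero m}} → ℝ
x /ₙ m = x * fromℚ (+ 1 ℚ./ m)

infix 4 _IsSqrtOf_

_IsSqrtOf_ : Rel ℝ 0ℓ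
r IsSqrtOf x = 0ℝ ≤ r × r * r ≃ x

+-0-rawMonoid : RawMonoid 0ℓ 0ℓ
+-0-rawMonoid = record { _≈_ = _≃_ ; _∙_ = _+_ ; ε = 0ℝ }

open RawMonoidDefs +-0-rawMonoid public using (sum)

sumOver : ∀ {n} → Subset n → Vector ℝ n → ℝ
sumOver V f = sum λ i → if does (i ∈? V) then f i else 0ℝ

infix 8 ⟨_,_⟩

⟨_,_⟩ : ∀ {n} → Vector ℝ n → Vector ℝ n → ℝ
⟨ u , v ⟩ = sum λ i → u i * v i

‖_‖² : ∀ {n} → Vector ℝ n → ℝ
‖ v ‖² = ⟨ v , v ⟩

δ : ∀ {n} → Fin n → Fin n → ℝ
δ i j = if does (i ≟ j) then 1ℝ else 0ℝ

------------------------------------------------------------------------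
-- Weighted graphs

record Graph (N : ℕ) : Set₁ where
  field
    Link        : Rel (Fin N) 0ℓ
    link?       : Decidable Link
    link-sym    : Symmetric Link
    link-irrefl : Irreflexive _≡_ Link
    -- Only the values at linked pairs are constrained or used.
    weight      : Fin N → Fin N → ℝ
    weight-sym  : ∀ {i j} → Link i j → weight i j ≃ weight j i
    weight-pos  : ∀ {i j} → Link i j → 0ℝ < weight i j

  weightOrZero : Fin N → Fin N → ℝ
  weightOrZero i j = if does (link? i j) then weight i j else 0ℝ

  degree : Fin N → ℝ
  degree i = sum λ j → weightOrZero i j

  laplacian : Fin N → Fin N → ℝ
  laplacian i j =
    if does (i ≟ j) then degree i else
    if does (link? i j) then - weight i j else 0ℝ

  -- A link with one endpoint in V and the other outside is counted
  -- once, as the pair (i , j) with i ∈ V and j ∉ V.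
  cut : Subset N → ℝ
  cut V = sumOver V λ i → sumOver (∁ V) λ j → weightOrZero i j

  Connected : Set
  Connected = ∀ i j → Star Link i j

-- An orthonormal family of eigenvectors z k of Q, with eigenvalues μ k
-- in non-increasing order (repeated according to multiplicity). For a
-- connected graph it follows that only the last μ vanishes and that the
-- others are positive, so this is not required here.
record Eigensystem {N} (Q : Fin N → Fin N → ℝ) : Set where
  field
    μ             : Vector ℝ N
    z             : Fin N → Vector ℝ N
    eigenvector   : ∀ k i → sum (λ j → Q i j * z k j) ≃ μ k * z k i
    orthonormal   : ∀ k l → ⟨ z k , z l ⟩ ≃ δ k l
    nonIncreasing : ∀ {k l} → k Fin.≤ l → μ l ≤ μ k

-- The simplex of a graph on N = n + 1 nodes, given by its vertices; it
-- depends on the choice of eigenvectors. The number √μ k is the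
-- nonnegative square root of the k-th eigenvalue. The last eigenvalue,
-- which is 0, is left out.
record Simplex {n} (G : Graph (suc n)) : Set where
  open Graph G
  field
    eigensystem : Eigensystem laplacian
  open Eigensystem eigensystem public
  field
    √μ      : Vector ℝ n
    √μ-sqrt : ∀ k → √μ k IsSqrtOf μ (inject₁ k)

  vertex : Fin (suc n) → Vector ℝ n
  vertex i k = z (inject₁ k) i * √μ k

------------------------------------------------------------------------
-- Centroids

nonempty⇒nonZero : ∀ {n} {V : Subset n} → Nonempty V → NonZero ∣ V ∣
nonempty⇒nonZero (_ , i∈V) = ℕ.>-nonZero (ℕ.≤-<-trans ℕ.z≤n (x∈p⇒∣p-x∣<∣p∣ i∈V))

proper⇒∁-nonempty : ∀ {n} {V : Subset n} → V ⊂ ⊤ → Nonempty (∁ V)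
proper⇒∁-nonempty (_ , i , _ , i∉V) = i , x∉p⇒x∈∁p i∉V

proper⇒∸-nonZero : ∀ {n} {V : Subset n} → V ⊂ ⊤ → NonZero (n ℕ.∸ ∣ V ∣)
proper⇒∸-nonZero {n} {V} V⊂⊤ = ℕ.>-nonZero
  (ℕ.m<n⇒0<n∸m (subst (∣ V ∣ ℕ.<_) (∣⊤∣≡n n) (p⊂q⇒∣p∣<∣q∣ V⊂⊤)))

square-nonZero : ∀ {m} → NonZero m → NonZero (m ℕ.^ 2)
square-nonZero {m} m≢0 = ℕ.m^n≢0 m 2 {{m≢0}}

centroid : ∀ {N n} → (Fin N → Vector ℝ n) → (V : Subset N) → Nonempty V → Vector ℝ n
centroid s V ne k = _/ₙ_ (sumOver V λ i → s i k) ∣ V ∣ {{nonempty⇒nonZero ne}}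

{-# OPTIONS --safe #-}

-- Write 1_V for the indicator vector of V. Since Q = ∑ₖ μₖ zₖzₖᵀ with
-- μ_N = 0, the squared norm of ∑_{i ∈ V} sᵢ is the quadratic form
-- 1_Vᵀ Q 1_V = ∑ᵢⱼ wᵢⱼ vᵢ (vᵢ − vⱼ) with v = 1_V, that is, the cut size.

module Submission where

open import Algebra.Bundles using (CommutativeRing)
open import Data.Bool.Base using (if_then_else_)
open import Data.Fin.Base using (Fin; zero; suc; inject₁; fromℕ)
open import Data.Fin.Properties using (_≟_; ≤fromℕ)
open import Data.Fin.Subset using (Subset; Nonempty; _⊂_; ⊤; ∁; ∣_∣)
open import Data.Fin.Subset.Properties using (_∈?_; x∈p⇒x∉∁p; x∉p⇒x∈∁p; ∣∁p∣≡n∸∣p∣)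
open import Data.Nat.Base as ℕ using (ℕ)
open import Data.Vec.Functional using (Vector)
open import Function.Base using (_∘_)
open import Level using (_⊔_; 0ℓ) renaming (suc to lsuc)
open import Relation.Binary.Definitions using (_Respects_)
open import Relation.Nullary.Decidable.Core using (does; yes; no)
open import Relation.Nullary.Negation using (contradiction)
open import Relation.Unary using (Pred)
import Relation.Binary.PropositionalEquality.Core as ≡

-- Ordered commutative rings, given by their nonnegative elements

record PositiveCone {c ℓ} (R : CommutativeRing c ℓ) p : Set (c ⊔ ℓ ⊔ lsuc p) where
  open CommutativeRing R
  field
    -- No comparison of arbitrary elements is assumed, since the order of Cauchy reals is not
    -- decidable constructively.
    NonNegative     : Pred Carrier p
    respects        : NonNegative Respects _≈_
    1-nonNegative   : NonNegative 1#
    +-closed        : ∀ {x y} → NonNegative x → NonNegative y → NonNegative (x + y)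
    *-square-closed : ∀ {x} y → NonNegative x → NonNegative (x * (y * y))
    pointed         : ∀ {x} → NonNegative x → NonNegative (- x) → x ≈ 0#
    -- Takes the place of division by 2, which a commutative ring need not allow.
    halve           : ∀ {x} → NonNegative (x + x) → NonNegative x
    square-zero     : ∀ {x} → x * x ≈ 0# → x ≈ 0#

module Simplices {c ℓ p} {R : CommutativeRing c ℓ} (C : PositiveCone R p) where

  open CommutativeRing R hiding (zero)
  open PositiveCone C
  open import Algebra.Properties.Semiring.Sum semiring
    using (sum; sum-cong-≋; sum-replicate-zero; ∑-comm; ∑-distrib-+)
    renaming (*-distribˡ-sum to ∑-distribˡ-*; *-distribʳ-sum to ∑-distribʳ-*)
  open import Algebra.Properties.Ring ring using (-‿distribˡ-*; -‿distribʳ-*)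
  open import Algebra.Properties.AbelianGroup +-abelianGroup
    using (inverseˡ-unique; ∙-cancelʳ; ⁻¹-anti-homo‿-; x∙y⁻¹≈ε⇒x≈y)
  open import Algebra.Solver.Ring.NaturalCoefficients.Default commutativeSemiring
    using (solve; _:+_; _:*_; _:=_)
  open import Relation.Binary.Reasoning.Setoid setoid

  private
    Matrix : ℕ → Set c
    Matrix n = Fin n → Fin n → Carrier

    variable
      n : ℕ

  -- Kronecker deltas and indicator vectors

  δ : Matrix n
  δ i j = if does (i ≟ j) then 1# else 0#

  sumOver : Subset n → Vector Carrier n → Carrier
  sumOver V f = sum λ i → if does (i ∈? V) then f i else 0#

  indicator : Subset n → Vector Carrier n
  indicator V i = if does (i ∈? V) then 1# else 0#

  sum-zero : {f : Vector Carrier n} → (∀ i → f i ≈ 0#) → sum f ≈ 0#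
  sum-zero {n} f≈0 = trans (sum-cong-≋ f≈0) (sum-replicate-zero n)

  sum-δ : ∀ i (f : Vector Carrier n) → sum (λ j → δ i j * f j) ≈ f i
  sum-δ zero f = trans (+-cong (*-identityˡ (f zero)) (sum-zero λ j → zeroˡ (f (suc j))))
    (+-identityʳ (f zero))
  sum-δ (suc i) f = trans (+-cong (zeroˡ (f zero)) (sum-δ i (f ∘ suc)))
    (+-identityˡ (f (suc i)))

  δ-diagonal : ∀ (i : Fin n) → δ i i ≈ 1#
  δ-diagonal i with i ≟ i
  ... | yes _  = refl
  ... | no i≢i = contradiction ≡.refl i≢i

  indicator-* : ∀ (V : Subset n) (f : Vector Carrier n) i →
                indicator V i * f i ≈ (if does (i ∈? V) then f i else 0#)
  indicator-* V f i with i ∈? V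
  ... | yes _ = *-identityˡ (f i)
  ... | no _  = zeroˡ (f i)

  sumOver-indicator : ∀ (V : Subset n) (f : Vector Carrier n) →
    sumOver V f ≈ sum λ i → indicator V i * f i
  sumOver-indicator {n} V f = sum-cong-≋ {n} λ i → sym (indicator-* V f i)

  -- With values 0 and 1 only, either side is 1 exactly when `i` lies in `V` and `j` does not.
  -- Membership in `V` and in `∁ V` are separate tests, so the inconsistent outcomes have to be
  -- refuted.
  indicator-∁ : ∀ (V : Subset n) i j →
    indicator V i * (indicator V i - indicator V j) ≈ indicator V i * indicator (∁ V) j
  indicator-∁ V i j with i ∈? V
  ... | no _ = trans (zeroˡ _) (sym (zeroˡ _))
  ... | yes _ with j ∈? V | j ∈? ∁ V
  ...   | yes _   | no _     = *-congˡ (-‿inverseʳ 1#)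
  ...   | yes j∈V | yes j∈∁V = contradiction j∈∁V (x∈p⇒x∉∁p j∈V)
  ...   | no j∉V  | no j∉∁V  = contradiction (x∉p⇒x∈∁p j∉V) j∉∁V
  ...   | no _    | yes _    = *-congˡ (trans (+-congˡ -0≈0) (+-identityʳ 1#))
    where
    -0≈0 : - 0# ≈ 0#
    -0≈0 = sym (inverseˡ-unique 0# 0# (+-identityˡ 0#))

  -- Sums of nonnegative elements

  0-nonNegative : NonNegative 0#
  0-nonNegative = respects (trans (*-identityˡ _) (zeroˡ 0#)) (*-square-closed 0# 1-nonNegative)

  square-nonNegative : ∀ x → NonNegative (x * x)
  square-nonNegative x = respects (*-identityˡ _) (*-square-closed x 1-nonNegative)

  sum-nonNegative : {f : Vector Carrier n} → (∀ i → NonNegative (f i)) → NonNegative (sum f)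
  sum-nonNegative {ℕ.zero}  f≥0 = 0-nonNegative
  sum-nonNegative {ℕ.suc n} f≥0 = +-closed (f≥0 zero) (sum-nonNegative (f≥0 ∘ suc))

  -- Here `y` is `- x`, so `x` and its negative both lie in the cone, which is pointed.
  +-zero : ∀ {x y} → NonNegative x → NonNegative y → x + y ≈ 0# → x ≈ 0#
  +-zero x≥0 y≥0 x+y≈0 = pointed x≥0
    (respects (inverseˡ-unique _ _ (trans (+-comm _ _) x+y≈0)) y≥0)

  sum-nonNegative-zero : {f : Vector Carrier n} → (∀ i → NonNegative (f i)) →
                         sum f ≈ 0# → ∀ i → f i ≈ 0#
  sum-nonNegative-zero f≥0 ∑f≈0 zero =
    +-zero (f≥0 zero) (sum-nonNegative (f≥0 ∘ suc)) ∑f≈0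
  sum-nonNegative-zero f≥0 ∑f≈0 (suc i) = sum-nonNegative-zero (f≥0 ∘ suc)
    (+-zero (sum-nonNegative (f≥0 ∘ suc)) (f≥0 zero) (trans (+-comm _ _) ∑f≈0)) i

  -- The length of the vectors is fixed here, since it cannot be inferred
  -- from a sum.
  module Sums (n : ℕ) where

    sum-cong : {f g : Vector Carrier n} → (∀ i → f i ≈ g i) → sum f ≈ sum g
    sum-cong = sum-cong-≋ {n}

    *-distribˡ-sum : ∀ x (f : Vector Carrier n) → x * sum f ≈ sum (λ i → x * f i)
    *-distribˡ-sum = ∑-distribˡ-* {n}

    *-distribʳ-sum : ∀ x (f : Vector Carrier n) → sum f * x ≈ sum (λ i → f i * x)
    *-distribʳ-sum = ∑-distribʳ-* {n}

    sum₂-cong : {f g : Matrix n} → (∀ i j → f i j ≈ g i j) →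
                sum (λ i → sum (f i)) ≈ sum (λ i → sum (g i))
    sum₂-cong f≈g = sum-cong λ i → sum-cong (f≈g i)

    sum-swap : (f : Matrix n) → sum (λ i → sum (λ j → f i j)) ≈ sum (λ j → sum (λ i → f i j))
    sum-swap = ∑-comm {n} {n}

    sum*sum : (f g : Vector Carrier n) → sum f * sum g ≈ sum λ i → sum λ j → f i * g j
    sum*sum f g = trans (*-distribʳ-sum (sum g) f)
      (sum-cong λ i → *-distribˡ-sum (f i) g)

  -- Quadratic forms and orthonormal families

  module Forms (n : ℕ) where

    open Sums n

    form : Matrix n → Vector Carrier n → Carrier
    form Q v = sum λ i → sum λ j → Q i j * (v i * v j)

    gram : Matrix n → Matrix n
    gram z i j = sum λ k → z k i * z k j

    -- Moving the sum over `k` outermost leaves, for each rank-one term, a double sum that factors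
    -- as the square of the coordinate of `v` along `z k`.
    form-spectral : ∀ (Q z : Matrix n) (μ : Vector Carrier n) →
      (∀ i j → Q i j ≈ sum λ k → μ k * (z k i * z k j)) → ∀ v →
      form Q v ≈ sum λ k → μ k * (sum (λ i → z k i * v i) * sum (λ i → z k i * v i))
    form-spectral Q z μ Q≈ v = begin
      (sum λ i → sum λ j → Q i j * (v i * v j))
        ≈⟨ sum₂-cong (λ i j → trans (*-congʳ (Q≈ i j)) (trans (*-distribʳ-sum (v i * v j) _)
             (sum-cong λ k → rearrange (μ k) (z k i) (z k j) (v i) (v j)))) ⟩
      (sum λ i → sum λ j → sum λ k → term k i j)
        ≈⟨ sum-cong (λ i → sum-swap (λ j k → term k i j)) ⟩
      (sum λ i → sum λ k → sum λ j → term k i j)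
        ≈⟨ sum-swap (λ i k → sum (term k i)) ⟩
      (sum λ k → sum λ i → sum λ j → term k i j)
        ≈⟨ sum-cong (λ k → trans (*-congˡ (sum*sum (coordinate k) (coordinate k)))
             (trans (*-distribˡ-sum (μ k) _)
               (sum-cong λ i → *-distribˡ-sum (μ k) _))) ⟨
      (sum λ k → μ k * (sum (coordinate k) * sum (coordinate k))) ∎
      where
      coordinate : Matrix _
      coordinate k i = z k i * v i
      term : Fin _ → Matrix _
      term k i j = μ k * (coordinate k i * coordinate k j)
      rearrange : ∀ m a b x y → (m * (a * b)) * (x * y) ≈ m * ((a * x) * (b * y))
      rearrange = solve 5 (λ m a b x y →
        (m :* (a :* b)) :* (x :* y) := m :* ((a :* x) :* (b :* y))) refl

    -- The rows of a square matrix Z being orthonormal, P = I − ZᵀZ is a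
    -- symmetric idempotent, so ∑ᵢⱼ Pᵢⱼ² = tr P = tr I − tr ZZᵀ = 0.
    module Orthonormal (z : Matrix n)
      (orthonormal : ∀ k l → sum (λ i → z k i * z l i) ≈ δ k l) where

      -- `gram z` is ZᵀZ, and (ZᵀZ)Zᵀ = Zᵀ(ZZᵀ) = Zᵀ because ZZᵀ = I.
      gram-fixes-rows : ∀ k i → sum (λ j → gram z i j * z k j) ≈ z k i
      gram-fixes-rows k i = begin
        (sum λ j → gram z i j * z k j)
          ≈⟨ sum-cong (λ j → trans (*-distribʳ-sum (z k j) _)
               (sum-cong λ l → rearrange (z l i) (z l j) (z k j))) ⟩
        (sum λ j → sum λ l → (z k j * z l j) * z l i)
          ≈⟨ sum-swap (λ j l → (z k j * z l j) * z l i) ⟩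
        (sum λ l → sum λ j → (z k j * z l j) * z l i)
          ≈⟨ sum-cong (λ l → *-distribʳ-sum (z l i) (λ j → z k j * z l j)) ⟨
        (sum λ l → sum (λ j → z k j * z l j) * z l i)
          ≈⟨ sum-cong (λ l → *-congʳ (orthonormal k l)) ⟩
        (sum λ l → δ k l * z l i)
          ≈⟨ sum-δ k (λ l → z l i) ⟩
        z k i ∎
        where
        rearrange : ∀ a b d → (a * b) * d ≈ (d * b) * a
        rearrange = solve 3 (λ a b d → (a :* b) :* d := (d :* b) :* a) refl

      -- As ZᵀZ is symmetric, this is the diagonal of (ZᵀZ)² = ZᵀZ. Only one factor is expanded; the
      -- other acts on the rows by `gram-fixes-rows`.
      gram-idempotent : ∀ i → sum (λ j → gram z i j * gram z i j) ≈ gram z i i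
      gram-idempotent i = begin
        (sum λ j → gram z i j * gram z i j)
          ≈⟨ sum-cong (λ j → trans (*-distribˡ-sum (gram z i j) _)
               (sum-cong λ k → rearrange (gram z i j) (z k i) (z k j))) ⟩
        (sum λ j → sum λ k → z k i * (gram z i j * z k j))
          ≈⟨ sum-swap (λ j k → z k i * (gram z i j * z k j)) ⟩
        (sum λ k → sum λ j → z k i * (gram z i j * z k j))
          ≈⟨ sum-cong (λ k → *-distribˡ-sum (z k i) (λ j → gram z i j * z k j)) ⟨
        (sum λ k → z k i * sum (λ j → gram z i j * z k j))
          ≈⟨ sum-cong (λ k → *-congˡ (gram-fixes-rows k i)) ⟩
        gram z i i ∎
        where
        rearrange : ∀ m a b → m * (a * b) ≈ a * (m * b)
        rearrange = solve 3 (λ m a b → m :* (a :* b) := a :* (m :* b)) refl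

      P : Matrix n
      P i j = δ i j - gram z i j

      P+gram : ∀ i j → P i j + gram z i j ≈ δ i j
      P+gram i j = trans (+-assoc _ _ _) (trans (+-congˡ (-‿inverseˡ _)) (+-identityʳ _))

      -- The square of a difference with its cross terms moved to the left. Writing `δ` as
      -- `P + gram` removes all subtraction, so that the semiring solver applies.
      P-square : ∀ i j → P i j * P i j + (δ i j * gram z i j + δ i j * gram z i j)
                       ≈ δ i j * δ i j + gram z i j * gram z i j
      P-square i j = begin
        P i j * P i j + (δ i j * gram z i j + δ i j * gram z i j)
          ≈⟨ +-congˡ (+-cong (*-congʳ (P+gram i j)) (*-congʳ (P+gram i j))) ⟨
        P i j * P i j + ((P i j + gram z i j) * gram z i j + (P i j + gram z i j) * gram z i j)
          ≈⟨ expand (P i j) (gram z i j) ⟩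
        (P i j + gram z i j) * (P i j + gram z i j) + gram z i j * gram z i j
          ≈⟨ +-congʳ (*-cong (P+gram i j) (P+gram i j)) ⟩
        δ i j * δ i j + gram z i j * gram z i j ∎
        where
        expand : ∀ a b → a * a + ((a + b) * b + (a + b) * b) ≈ (a + b) * (a + b) + b * b
        expand = solve 2 (λ a b →
          a :* a :+ ((a :+ b) :* b :+ (a :+ b) :* b) := (a :+ b) :* (a :+ b) :+ b :* b) refl

      -- Summing `P-square` over `j`, the cross terms give `gram z i i` twice and the squares on the
      -- right give it once; one copy cancels.
      P-row : ∀ i → sum (λ j → P i j * P i j) + gram z i i ≈ δ i i
      P-row i = ∙-cancelʳ (gram z i i) _ _ (begin
        (sum (λ j → P i j * P i j) + gram z i i) + gram z i i
          ≈⟨ +-assoc _ _ _ ⟩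
        sum (λ j → P i j * P i j) + (gram z i i + gram z i i)
          ≈⟨ +-congˡ (+-cong (sum-δ i (gram z i)) (sum-δ i (gram z i))) ⟨
        sum (λ j → P i j * P i j) +
          (sum (λ j → δ i j * gram z i j) + sum (λ j → δ i j * gram z i j))
          ≈⟨ +-congˡ (∑-distrib-+ (λ j → δ i j * gram z i j) (λ j → δ i j * gram z i j)) ⟨
        sum (λ j → P i j * P i j) + sum (λ j → δ i j * gram z i j + δ i j * gram z i j)
          ≈⟨ ∑-distrib-+ (λ j → P i j * P i j) (λ j → δ i j * gram z i j + δ i j * gram z i j) ⟨
        (sum λ j → P i j * P i j + (δ i j * gram z i j + δ i j * gram z i j))
          ≈⟨ sum-cong (P-square i) ⟩
        (sum λ j → δ i j * δ i j + gram z i j * gram z i j)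
          ≈⟨ ∑-distrib-+ (λ j → δ i j * δ i j) (λ j → gram z i j * gram z i j) ⟩
        sum (λ j → δ i j * δ i j) + sum (λ j → gram z i j * gram z i j)
          ≈⟨ +-cong (sum-δ i (δ i)) (gram-idempotent i) ⟩
        δ i i + gram z i i ∎)

      -- Summing `P-row` over `i` compares two traces: tr I = tr ZZᵀ by orthonormality, and tr ZZᵀ =
      -- tr ZᵀZ by exchanging the sums.
      P-norm : sum (λ i → sum (λ j → P i j * P i j)) ≈ 0#
      P-norm = ∙-cancelʳ (sum λ i → gram z i i) _ _ (begin
        sum (λ i → sum (λ j → P i j * P i j)) + sum (λ i → gram z i i)
          ≈⟨ ∑-distrib-+ (λ i → sum (λ j → P i j * P i j)) (λ i → gram z i i) ⟨
        (sum λ i → sum (λ j → P i j * P i j) + gram z i i)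
          ≈⟨ sum-cong P-row ⟩
        (sum λ (k : Fin n) → δ k k)
          ≈⟨ sum-cong (λ k → orthonormal k k) ⟨
        (sum λ k → sum λ i → z k i * z k i)
          ≈⟨ sum-swap (λ k i → z k i * z k i) ⟩
        (sum λ i → gram z i i)
          ≈⟨ +-identityˡ _ ⟨
        0# + sum (λ i → gram z i i) ∎)

      -- A vanishing sum of squares has vanishing terms. This is completeness: n orthonormal vectors
      -- in dimension n resolve the identity.
      gram≈δ : ∀ i j → gram z i j ≈ δ i j
      gram≈δ i j = sym (x∙y⁻¹≈ε⇒x≈y (δ i j) (gram z i j) (square-zero
        (sum-nonNegative-zero (λ j → square-nonNegative (P i j))
          (sum-nonNegative-zero (λ i → sum-nonNegative λ j → square-nonNegative (P i j))
            P-norm i) j)))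

      -- The spectral form of the identity matrix, all of whose eigenvalues are 1.
      parseval : ∀ v → sum (λ k → sum (λ i → z k i * v i) * sum (λ i → z k i * v i))
                     ≈ sum (λ i → v i * v i)
      parseval v = begin
        (sum λ k → sum (λ i → z k i * v i) * sum (λ i → z k i * v i))
          ≈⟨ sum-cong (λ k → *-identityˡ _) ⟨
        (sum λ k → 1# * (sum (λ i → z k i * v i) * sum (λ i → z k i * v i)))
          ≈⟨ form-spectral δ z (λ _ → 1#)
               (λ i j → trans (sym (gram≈δ i j)) (sum-cong λ k → sym (*-identityˡ _))) v ⟨
        form δ v
          ≈⟨ sum-cong (λ i → sum-δ i (λ j → v i * v j)) ⟩
        (sum λ i → v i * v i) ∎

      -- Q = QI, with I resolved as the sum of the zₖzₖᵀ by `gram≈δ`; then Q acts on each zₖ.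
      spectral : (Q : Matrix n) (μ : Vector Carrier n) →
        (∀ k i → sum (λ j → Q i j * z k j) ≈ μ k * z k i) →
        ∀ i j → Q i j ≈ sum λ k → μ k * (z k i * z k j)
      spectral Q μ eigenvector i j = begin
        Q i j
          ≈⟨ sum-δ j (Q i) ⟨
        (sum λ l → δ j l * Q i l)
          ≈⟨ sum-cong (λ l → *-congʳ (gram≈δ j l)) ⟨
        (sum λ l → gram z j l * Q i l)
          ≈⟨ sum-cong (λ l → trans (*-distribʳ-sum (Q i l) _)
               (sum-cong λ k → rearrange (z k j) (z k l) (Q i l))) ⟩
        (sum λ l → sum λ k → (Q i l * z k l) * z k j)
          ≈⟨ sum-swap (λ l k → (Q i l * z k l) * z k j) ⟩
        (sum λ k → sum λ l → (Q i l * z k l) * z k j)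
          ≈⟨ sum-cong (λ k → *-distribʳ-sum (z k j) (λ l → Q i l * z k l)) ⟨
        (sum λ k → sum (λ l → Q i l * z k l) * z k j)
          ≈⟨ sum-cong (λ k → trans (*-congʳ (eigenvector k i)) (*-assoc _ _ _)) ⟩
        (sum λ k → μ k * (z k i * z k j)) ∎
        where
        rearrange : ∀ a b q → (a * b) * q ≈ (q * b) * a
        rearrange = solve 3 (λ a b q → (a :* b) :* q := (q :* b) :* a) refl

    -- The quadratic form of a Laplacian

    module Laplacian (W Q : Matrix n)
      (Q≈D-W : ∀ i j → Q i j ≈ δ i j * sum (W i) - W i j) where

      -- The diagonal term, being the row sum of `W` times `v i * v i`, is spread back over `j` and
      -- paired with the off-diagonal terms. Left unsymmetrised, the sum counts each cut link once
      -- when `v` is an indicator.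
      form-Dirichlet : ∀ v → form Q v ≈ sum λ i → sum λ j → W i j * (v i * (v i - v j))
      form-Dirichlet v = sum-cong λ i → begin
        (sum λ j → Q i j * (v i * v j))
          ≈⟨ sum-cong (λ j → trans (*-congʳ (Q≈D-W i j)) (split (δ i j) (sum (W i)) (- W i j) _)) ⟩
        (sum λ j → δ i j * (sum (W i) * (v i * v j)) + - W i j * (v i * v j))
          ≈⟨ ∑-distrib-+ (λ j → δ i j * (sum (W i) * (v i * v j))) (λ j → - W i j * (v i * v j)) ⟩
        sum (λ j → δ i j * (sum (W i) * (v i * v j))) + sum (λ j → - W i j * (v i * v j))
          ≈⟨ +-congʳ (trans (sum-δ i (λ j → sum (W i) * (v i * v j)))
               (*-distribʳ-sum (v i * v i) (W i))) ⟩
        sum (λ j → W i j * (v i * v i)) + sum (λ j → - W i j * (v i * v j))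
          ≈⟨ ∑-distrib-+ (λ j → W i j * (v i * v i)) (λ j → - W i j * (v i * v j)) ⟨
        (sum λ j → W i j * (v i * v i) + - W i j * (v i * v j))
          ≈⟨ sum-cong (λ j → trans (+-congˡ (move (W i j) (v i) (v j)))
               (factor (W i j) (v i) (- v j))) ⟩
        (sum λ j → W i j * (v i * (v i - v j))) ∎
        where
        split : ∀ d s w x → (d * s + w) * x ≈ d * (s * x) + w * x
        split = solve 4 (λ d s w x → (d :* s :+ w) :* x := d :* (s :* x) :+ w :* x) refl
        factor : ∀ w a b → w * (a * a) + w * (a * b) ≈ w * (a * (a + b))
        factor = solve 3 (λ w a b → w :* (a :* a) :+ w :* (a :* b) := w :* (a :* (a :+ b))) refl
        -- The sign is shifted onto `v j`, so that `factor` can treat `- v j` as an atom of a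
        -- semiring identity.
        move : ∀ w a b → - w * (a * b) ≈ w * (a * - b)
        move w a b = begin
          - w * (a * b)   ≈⟨ -‿distribˡ-* w (a * b) ⟨
          - (w * (a * b)) ≈⟨ -‿distribʳ-* w (a * b) ⟩
          w * - (a * b)   ≈⟨ *-congˡ (-‿distribʳ-* a b) ⟩
          w * (a * - b)   ∎

      form-1≈0 : form Q (λ _ → 1#) ≈ 0#
      form-1≈0 = trans (form-Dirichlet (λ _ → 1#)) (sum-zero λ i → sum-zero λ j →
        trans (*-congˡ (trans (*-congˡ (-‿inverseʳ 1#)) (zeroʳ 1#))) (zeroʳ (W i j)))

      form-cut : ∀ V → form Q (indicator V) ≈ sumOver V λ i → sumOver (∁ V) λ j → W i j
      form-cut V = begin
        form Q (indicator V)
          ≈⟨ form-Dirichlet (indicator V) ⟩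
        (sum λ i → sum λ j → W i j * (indicator V i * (indicator V i - indicator V j)))
          ≈⟨ sum₂-cong (λ i j → trans (*-congˡ (indicator-∁ V i j))
               (rearrange (W i j) (indicator V i) (indicator (∁ V) j))) ⟩
        (sum λ i → sum λ j → indicator V i * (indicator (∁ V) j * W i j))
          ≈⟨ sum-cong (λ i → trans (*-congˡ (sumOver-indicator (∁ V) (W i)))
               (*-distribˡ-sum (indicator V i) _)) ⟨
        (sum λ i → indicator V i * sumOver (∁ V) (W i))
          ≈⟨ sumOver-indicator V (λ i → sumOver (∁ V) (W i)) ⟨
        sumOver V (λ i → sumOver (∁ V) (W i)) ∎
        where
        rearrange : ∀ w a b → w * (a * b) ≈ a * (b * w)
        rearrange = solve 3 (λ w a b → w :* (a :* b) := a :* (b :* w)) refl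

      module _ (W-sym : ∀ i j → W i j ≈ W j i) (W≥0 : ∀ i j → NonNegative (W i j)) where

        -- One copy of the Dirichlet sum has `i` and `j` exchanged, using the symmetry of `W`; the
        -- two copies add up to squared differences.
        form-doubled : ∀ v → form Q v + form Q v
                           ≈ sum λ i → sum λ j → W i j * ((v i - v j) * (v i - v j))
        form-doubled v = begin
          form Q v + form Q v
            ≈⟨ +-cong (form-Dirichlet v) (trans (form-Dirichlet v)
                 (trans (sum-swap E) (sum₂-cong λ i j → *-congʳ (W-sym j i)))) ⟩
          sum (λ i → sum (E i)) + sum (λ i → sum (F i))
            ≈⟨ ∑-distrib-+ (λ i → sum (E i)) (λ i → sum (F i)) ⟨
          (sum λ i → sum (E i) + sum (F i))
            ≈⟨ sum-cong (λ i → ∑-distrib-+ (E i) (F i)) ⟨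
          (sum λ i → sum λ j → E i j + F i j)
            ≈⟨ sum₂-cong (λ i j → trans (+-congˡ (*-congˡ (flip (v i) (v j))))
                 (factor (W i j) (v i) (- v j) (v i - v j))) ⟩
          (sum λ i → sum λ j → W i j * ((v i - v j) * (v i - v j))) ∎
          where
          E F : Matrix n
          E i j = W i j * (v i * (v i - v j))
          F i j = W i j * (v j * (v j - v i))
          flip : ∀ a b → b * (b - a) ≈ - b * (a - b)
          flip a b = begin
            b * (b - a)     ≈⟨ *-congˡ (⁻¹-anti-homo‿- a b) ⟨
            b * - (a - b)   ≈⟨ -‿distribʳ-* b (a - b) ⟨
            - (b * (a - b)) ≈⟨ -‿distribˡ-* b (a - b) ⟩
            - b * (a - b)   ∎
          factor : ∀ w a b d → w * (a * d) + w * (b * d) ≈ w * ((a + b) * d)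
          factor = solve 4 (λ w a b d →
            w :* (a :* d) :+ w :* (b :* d) := w :* ((a :+ b) :* d)) refl

        form-nonNegative : ∀ v → NonNegative (form Q v)
        form-nonNegative v = halve (respects (sym (form-doubled v))
          (sum-nonNegative λ i → sum-nonNegative λ j → *-square-closed (v i - v j) (W≥0 i j)))

  -- Laplacian eigenvalues and the norm of a sum of simplex vertices

  -- The number N of eigenvalues is not literally suc n, because a sum over
  -- Fin (suc n) unfolds and then obstructs unification.
  module Spectrum (n N : ℕ) (others : Fin n → Fin N) (last : Fin N)
    (sum-split : ∀ (t : Vector Carrier N) → sum t ≈ sum (λ k → t (others k)) + t last)
    (W Q : Matrix N)
    (Q≈D-W : ∀ i j → Q i j ≈ δ i j * sum (W i) - W i j)
    (W-sym : ∀ i j → W i j ≈ W j i) (W≥0 : ∀ i j → NonNegative (W i j))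
    (z : Matrix N) (μ : Vector Carrier N)
    (orthonormal : ∀ k l → sum (λ i → z k i * z l i) ≈ δ k l)
    (eigenvector : ∀ k i → sum (λ j → Q i j * z k j) ≈ μ k * z k i)
    (μ-last-minimal : ∀ k → NonNegative (μ k - μ (last)))
    where

    open Forms N
    private
      module N = Sums N
      module n = Sums n
    open Orthonormal z orthonormal
    open Laplacian W Q Q≈D-W

    -- The form is nonnegative, and at the unit eigenvector `z k` its value is `μ k`.
    eigenvalue-nonNegative : ∀ k → NonNegative (μ k)
    eigenvalue-nonNegative k = respects form≈μ (form-nonNegative W-sym W≥0 (z k))
      where
      rearrange : ∀ q a b → q * (a * b) ≈ (q * b) * a
      rearrange = solve 3 (λ q a b → q :* (a :* b) := (q :* b) :* a) refl
      form≈μ : form Q (z k) ≈ μ k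
      form≈μ = begin
        form Q (z k)
          ≈⟨ N.sum-cong (λ i → trans (N.sum-cong λ j → rearrange (Q i j) (z k i) (z k j))
               (sym (N.*-distribʳ-sum (z k i) (λ j → Q i j * z k j)))) ⟩
        (sum λ i → sum (λ j → Q i j * z k j) * z k i)
          ≈⟨ N.sum-cong (λ i → trans (*-congʳ (eigenvector k i)) (*-assoc _ _ _)) ⟩
        (sum λ i → μ k * (z k i * z k i))
          ≈⟨ N.*-distribˡ-sum (μ k) (λ i → z k i * z k i) ⟨
        μ k * sum (λ i → z k i * z k i)
          ≈⟨ *-congˡ (trans (orthonormal k k) (δ-diagonal k)) ⟩
        μ k * 1#
          ≈⟨ *-identityʳ (μ k) ⟩
        μ k ∎

    form≈∑ : ∀ v → form Q v ≈
      sum λ k → μ k * (sum (λ i → z k i * v i) * sum (λ i → z k i * v i))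
    form≈∑ = form-spectral Q z μ (spectral Q μ eigenvector)

    -- Evaluating the form at the all-ones vector, with coordinates c k,
    -- gives 0 = ∑ₖ μₖ cₖ² ≥ μ_N ∑ₖ cₖ² = N μ_N.
    last-eigenvalue≈0 : μ last ≈ 0#
    last-eigenvalue≈0 = pointed (eigenvalue-nonNegative last) (respects
      -- One of the N copies of μ_N is split off: `A` plus the other n copies equals `- μ last` and
      -- is nonnegative, while `μ last` is nonnegative too.
      (inverseˡ-unique (A + μ last * K) (μ last) A+μK+μ≈0)
      (+-closed
        (sum-nonNegative λ k → *-square-closed (c₁ k) (μ-last-minimal k))
        (respects (sym (n.*-distribˡ-sum (μ last) _))
          (sum-nonNegative λ (_ : Fin n) → *-square-closed 1# (eigenvalue-nonNegative last)))))
      where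
      c₁ : Vector Carrier N
      c₁ k = sum λ i → z k i * 1#
      A K : Carrier
      A = sum λ k → (μ k - μ last) * (c₁ k * c₁ k)
      -- The summand stays a product, as `parseval` yields it at the all-ones vector and as
      -- `*-square-closed` expects it.
      K = sum λ (_ : Fin n) → 1# * 1#
      recombine : ∀ k → (μ k - μ last) * (c₁ k * c₁ k) + μ last * (c₁ k * c₁ k)
                      ≈ μ k * (c₁ k * c₁ k)
      recombine k = trans (sym (distribʳ _ _ _)) (*-congʳ
        (trans (+-assoc _ _ _) (trans (+-congˡ (-‿inverseˡ _)) (+-identityʳ _))))
      A+μK+μ≈0 : A + μ last * K + μ last ≈ 0#
      A+μK+μ≈0 = begin
        A + μ last * K + μ last
          ≈⟨ +-assoc _ _ _ ⟩
        A + (μ last * K + μ last)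
          ≈⟨ +-congˡ (+-congˡ (trans (*-congˡ (*-identityˡ 1#)) (*-identityʳ _))) ⟨
        A + (μ last * K + μ last * (1# * 1#))
          ≈⟨ +-congˡ (distribˡ _ _ _) ⟨
        A + μ last * (K + 1# * 1#)
          ≈⟨ +-congˡ (*-congˡ (sum-split (λ _ → 1# * 1#))) ⟨
        A + μ last * sum (λ (_ : Fin N) → 1# * 1#)
          ≈⟨ +-congˡ (*-congˡ (parseval (λ _ → 1#))) ⟨
        A + μ last * sum (λ k → c₁ k * c₁ k)
          ≈⟨ +-congˡ (N.*-distribˡ-sum (μ last) (λ k → c₁ k * c₁ k)) ⟩
        A + sum (λ k → μ last * (c₁ k * c₁ k))
          ≈⟨ ∑-distrib-+ (λ k → (μ k - μ last) * (c₁ k * c₁ k)) (λ k → μ last * (c₁ k * c₁ k)) ⟨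
        (sum λ k → (μ k - μ last) * (c₁ k * c₁ k) + μ last * (c₁ k * c₁ k))
          ≈⟨ N.sum-cong recombine ⟩
        (sum λ k → μ k * (c₁ k * c₁ k))
          ≈⟨ form≈∑ (λ _ → 1#) ⟨
        form Q (λ _ → 1#)
          ≈⟨ form-1≈0 ⟩
        0# ∎

    -- Coordinate `k` of the vertex sum is `√μ k` times the coordinate of 1_V along the eigenvector,
    -- so its square is a term of the spectral form. The scalar `r` will be 1/V.
    norm-scaled-sum : ∀ (√μ : Vector Carrier n) → (∀ k → √μ k * √μ k ≈ μ (others k)) →
      ∀ V r → let s = λ k → sumOver V (λ i → z (others k) i * √μ k) * r in
      sum (λ k → s k * s k) ≈ sumOver V (λ i → sumOver (∁ V) λ j → W i j) * (r * r)
    norm-scaled-sum √μ √μ² V r = begin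
      (sum λ k → (σ k * r) * (σ k * r))
        ≈⟨ n.sum-cong (λ k → trans (square (σ k) r) (*-congʳ (σ² k))) ⟩
      (sum λ k → term (others k) * (r * r))
        ≈⟨ n.*-distribʳ-sum (r * r) (λ k → term (others k)) ⟨
      sum (λ k → term (others k)) * (r * r)
        -- The simplex has only n coordinates; the missing spectral term vanishes with the last
        -- eigenvalue.
        ≈⟨ *-congʳ (trans (sum-split term) (trans
             (+-congˡ (trans (*-congʳ last-eigenvalue≈0) (zeroˡ _))) (+-identityʳ _))) ⟨
      sum term * (r * r)
        ≈⟨ *-congʳ (form≈∑ (indicator V)) ⟨
      form Q (indicator V) * (r * r)
        ≈⟨ *-congʳ (form-cut V) ⟩
      sumOver V (λ i → sumOver (∁ V) λ j → W i j) * (r * r) ∎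
      where
      σ : Vector Carrier n
      σ k = sumOver V λ i → z (others k) i * √μ k
      coordinate term : Vector Carrier N
      coordinate k = sum λ i → z k i * indicator V i
      term k = μ k * (coordinate k * coordinate k)
      square : ∀ a b → (a * b) * (a * b) ≈ (a * a) * (b * b)
      square = solve 2 (λ a b → (a :* b) :* (a :* b) := (a :* a) :* (b :* b)) refl
      rearrange : ∀ a b d → a * (b * d) ≈ d * (b * a)
      rearrange = solve 3 (λ a b d → a :* (b :* d) := d :* (b :* a)) refl
      σ≈ : ∀ k → σ k ≈ √μ k * coordinate (others k)
      σ≈ k = trans (sumOver-indicator V _) (trans
        (N.sum-cong λ i → rearrange (indicator V i) (z (others k) i) (√μ k))
        (sym (N.*-distribˡ-sum (√μ k) _)))
      σ² : ∀ k → σ k * σ k ≈ term (others k)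
      σ² k = trans (*-cong (σ≈ k) (σ≈ k)) (trans (square _ _) (*-congʳ (√μ² k)))

-- The ordered ring of real numbers

open import Defs
open import Algebra.Structures using (IsCommutativeRing)
open import Data.Integer.Base using (+_)
open import Data.Nat.Base as ℕ using (ℕ; suc; _∸_; _^_; NonZero) renaming (_≤_ to _≤ₙ_)
import Data.Nat.Properties as ℕ
open import Data.Product.Base using (_×_; _,_; proj₂)
open import Data.Rational.Base as ℚ using (ℚ; 0ℚ; 1ℚ; ½)
import Data.Rational.Properties as ℚ
import Data.Rational.Unnormalised.Base as ℚᵘ
import Data.Rational.Unnormalised.Properties as ℚᵘ
open import Data.Rational.Solver using (module +-*-Solver)
open import Data.Sum.Base using (inj₁; inj₂)
open import Relation.Binary.PropositionalEquality
  using (_≡_; refl; sym; trans; cong; cong₂; subst; subst₂)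

open +-*-Solver using (solve; _:+_; _:*_; _:-_; :-_; _:=_)

-- Inequalities between rational numbers

module _ where
  open import Algebra.Properties.AbelianGroup ℚ.+-0-abelianGroup

  ∣p-q∣≡∣q-p∣ : ∀ p q → ℚ.∣ p ℚ.- q ∣ ≡ ℚ.∣ q ℚ.- p ∣
  ∣p-q∣≡∣q-p∣ p q =
    trans (sym (ℚ.∣-p∣≡∣p∣ (p ℚ.- q))) (cong ℚ.∣_∣ (⁻¹-anti-homo‿- p q))

p-0≡p : ∀ p → p ℚ.- 0ℚ ≡ p
p-0≡p = ℚ.+-identityʳ

p≤∣p∣ : ∀ p → p ℚ.≤ ℚ.∣ p ∣
p≤∣p∣ p with ℚ.≤-total 0ℚ p
... | inj₁ 0≤p = ℚ.≤-reflexive (sym (ℚ.0≤p⇒∣p∣≡p 0≤p))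
... | inj₂ p≤0 = ℚ.≤-trans p≤0 (ℚ.0≤∣p∣ p)

∣p∣<q : ∀ {p q} → p ℚ.< q → ℚ.- p ℚ.< q → ℚ.∣ p ∣ ℚ.< q
∣p∣<q {p} {q} p<q -p<q with ℚ.∣p∣≡p∨∣p∣≡-p p
... | inj₁ eq = subst (ℚ._< q) (sym eq) p<q
... | inj₂ eq = subst (ℚ._< q) (sym eq) -p<q

-- Turns the shape to which `0ℝ ≤ x` unfolds into the lower half of a bound on an absolute value.
0<p+q⇒-p<q : ∀ {p q} → 0ℚ ℚ.< p ℚ.+ q → ℚ.- p ℚ.< q
0<p+q⇒-p<q {p} {q} 0<p+q = subst₂ ℚ._<_ (ℚ.+-identityʳ (ℚ.- p))
  (solve 2 (λ p q → :- p :+ (p :+ q) := q) refl p q) (ℚ.+-monoʳ-< (ℚ.- p) 0<p+q)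

-p<q⇒0<p+q : ∀ {p q} → ℚ.- p ℚ.< q → 0ℚ ℚ.< p ℚ.+ q
-p<q⇒0<p+q {p} {q} -p<q = subst (ℚ._< p ℚ.+ q) (ℚ.+-inverseʳ p) (ℚ.+-monoʳ-< p -p<q)

0<p*p : ∀ {p} → 0ℚ ℚ.< p → 0ℚ ℚ.< p ℚ.* p
0<p*p {p} 0<p = subst (ℚ._< p ℚ.* p) (ℚ.*-zeroʳ p)
  (ℚ.*-monoʳ-<-pos p {{ℚ.positive 0<p}} 0<p)

0≤p*q : ∀ {p q} → 0ℚ ℚ.≤ p → 0ℚ ℚ.≤ q → 0ℚ ℚ.≤ p ℚ.* q
0≤p*q {p} {q} 0≤p 0≤q = subst (ℚ._≤ p ℚ.* q) (ℚ.*-zeroʳ p)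
  (ℚ.*-monoˡ-≤-nonNeg p {{ℚ.nonNegative 0≤p}} 0≤q)

0≤p*p : ∀ p → 0ℚ ℚ.≤ p ℚ.* p
0≤p*p p = subst (0ℚ ℚ.≤_) ∣p∣*∣p∣≡p*p (0≤p*q (ℚ.0≤∣p∣ p) (ℚ.0≤∣p∣ p))
  where
  ∣p∣*∣p∣≡p*p : ℚ.∣ p ∣ ℚ.* ℚ.∣ p ∣ ≡ p ℚ.* p
  ∣p∣*∣p∣≡p*p with ℚ.∣p∣≡p∨∣p∣≡-p p
  ... | inj₁ eq rewrite eq = refl
  ... | inj₂ eq rewrite eq = solve 1 (λ p → :- p :* :- p := p :* p) refl p

-- Reduction to lowest terms blocks computation, so the product is taken among unnormalised
-- fractions. The separate `o` admits `m ^ 2`, which unfolds to `m * (m * 1)`.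
reciprocal-* : ∀ m {o} → m ℕ.* m ≡ o → .{{_ : NonZero m}} .{{_ : NonZero o}} →
               (+ 1 ℚ./ m) ℚ.* (+ 1 ℚ./ m) ≡ + 1 ℚ./ o
reciprocal-* (suc k) refl = ℚ.toℚᵘ-injective (begin
  ℚ.toℚᵘ (1/m ℚ.* 1/m)               ≈⟨ ℚ.toℚᵘ-homo-* 1/m 1/m ⟩
  ℚ.toℚᵘ 1/m ℚᵘ.* ℚ.toℚᵘ 1/m         ≈⟨ ℚᵘ.*-cong (ℚ.toℚᵘ-fromℚᵘ 1/mᵘ) (ℚ.toℚᵘ-fromℚᵘ 1/mᵘ) ⟩
  1/mᵘ ℚᵘ.* 1/mᵘ                     ≈⟨ ℚ.toℚᵘ-fromℚᵘ (1/mᵘ ℚᵘ.* 1/mᵘ) ⟨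
  ℚ.toℚᵘ (+ 1 ℚ./ (suc k ℕ.* suc k)) ∎)
  where
  open ℚᵘ.≃-Reasoning
  1/m  = + 1 ℚ./ suc k
  1/mᵘ = ℚᵘ.mkℚᵘ (+ 1) k

-- The commutative ring of Cauchy reals

both : ∀ {P Q R : ℕ → Set} → (∀ {m} → P m → Q m → R m) →
       Eventually P → Eventually Q → Eventually R
both f (m₁ , p) (m₂ , q) = m₁ ℕ.⊔ m₂ , λ m m≥ →
  f (p m (ℕ.m⊔n≤o⇒m≤o m₁ m₂ m≥)) (q m (ℕ.m⊔n≤o⇒n≤o m₁ m₂ m≥))

map-eventually : ∀ {P Q : ℕ → Set} → (∀ {m} → P m → Q m) → Eventually P → Eventually Q
map-eventually f (m₀ , p) = m₀ , λ m m≥ → f (p m m≥)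

pointwise : ∀ x y → (∀ m → seq x m ≡ seq y m) → x ≃ y
pointwise x y eq ε 0<ε = 0 , λ m _ → subst (ℚ._< ε)
  (sym (cong ℚ.∣_∣ (trans (cong (ℚ._- seq y m) (eq m)) (ℚ.+-inverseʳ (seq y m))))) 0<ε

≃-refl : ∀ x → x ≃ x
≃-refl x = pointwise x x λ _ → refl

≃-sym : ∀ x y → x ≃ y → y ≃ x
≃-sym x y x≃y ε 0<ε = map-eventually
  (λ {m} → subst (ℚ._< ε) (∣p-q∣≡∣q-p∣ (seq x m) (seq y m))) (x≃y ε 0<ε)

≃-trans : ∀ x y z → x ≃ y → y ≃ z → x ≃ z
≃-trans x y z x≃y y≃z ε 0<ε = both
  (λ {m} → triangle (sym (telescope (seq x m) (seq y m) (seq z m))))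
  (x≃y _ (half-pos 0<ε)) (y≃z _ (half-pos 0<ε))

+-cong : ∀ x x′ y y′ → x ≃ x′ → y ≃ y′ → x + y ≃ x′ + y′
+-cong x x′ y y′ x≃x′ y≃y′ ε 0<ε = both
  (λ {m} → triangle (+-difference (seq x m) (seq y m) (seq x′ m) (seq y′ m)))
  (x≃x′ _ (half-pos 0<ε)) (y≃y′ _ (half-pos 0<ε))

-‿cong : ∀ x y → x ≃ y → - x ≃ - y
-‿cong x y x≃y ε 0<ε = map-eventually
  (λ {m} → subst (ℚ._< ε) (trans (∣p-q∣≡∣q-p∣ (seq x m) (seq y m))
    (cong ℚ.∣_∣ (solve 2 (λ p q → q :- p := :- p :- :- q) refl (seq x m) (seq y m)))))
  (x≃y ε 0<ε)

-- By `*-difference` the error is `x` times one small difference plus `y′` times another; both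
-- factors are bounded, and `shrink` supplies the tolerances.
*-cong : ∀ x x′ y y′ → x ≃ x′ → y ≃ y′ → x * y ≃ x′ * y′
*-cong x x′ y y′ x≃x′ y≃y′ ε 0<ε with bounded x | bounded y′
... | b , 0<b , x≤b | c , 0<c , y′≤c
  with shrink _ b (half-pos 0<ε) 0<b | shrink _ c (half-pos 0<ε) 0<c
... | δ₁ , 0<δ₁ , small₁ | δ₂ , 0<δ₂ , small₂ = both
  (λ {m} → triangle (*-difference (seq x m) (seq y m) (seq x′ m) (seq y′ m)))
  (both (λ {m} → small₁ (seq x m) (seq y m ℚ.- seq y′ m)) x≤b (y≃y′ δ₁ 0<δ₁))
  (both (λ {m} → small₂ (seq y′ m) (seq x m ℚ.- seq x′ m)) y′≤c (x≃x′ δ₂ 0<δ₂))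

+-*-isCommutativeRing : IsCommutativeRing _≃_ _+_ _*_ -_ 0ℝ 1ℝ
+-*-isCommutativeRing = record
  { isRing = record
    { +-isAbelianGroup = record
      { isGroup = record
        { isMonoid = record
          { isSemigroup = record
            { isMagma = record
              { isEquivalence = record
                { refl  = λ {x} → ≃-refl x
                ; sym   = λ {x} {y} → ≃-sym x y
                ; trans = λ {x} {y} {z} → ≃-trans x y z
                }
              ; ∙-cong = λ {x} {x′} {y} {y′} → +-cong x x′ y y′
              }
            ; assoc = λ x y z → pointwise (x + y + z) (x + (y + z))
                λ m → ℚ.+-assoc (seq x m) (seq y m) (seq z m)
            }
          ; identity = (λ x → pointwise (0ℝ + x) x λ m → ℚ.+-identityˡ (seq x m))
                     , (λ x → pointwise (x + 0ℝ) x λ m → ℚ.+-identityʳ (seq x m))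
          }
        ; inverse = (λ x → pointwise (- x + x) 0ℝ λ m → ℚ.+-inverseˡ (seq x m))
                  , (λ x → pointwise (x + - x) 0ℝ λ m → ℚ.+-inverseʳ (seq x m))
        ; ⁻¹-cong = λ {x} {y} → -‿cong x y
        }
      ; comm = λ x y → pointwise (x + y) (y + x) λ m → ℚ.+-comm (seq x m) (seq y m)
      }
    ; *-cong = λ {x} {x′} {y} {y′} → *-cong x x′ y y′
    ; *-assoc = λ x y z → pointwise (x * y * z) (x * (y * z))
        λ m → ℚ.*-assoc (seq x m) (seq y m) (seq z m)
    ; *-identity = (λ x → pointwise (1ℝ * x) x λ m → ℚ.*-identityˡ (seq x m))
                 , (λ x → pointwise (x * 1ℝ) x λ m → ℚ.*-identityʳ (seq x m))
    ; distrib = (λ x y z → pointwise (x * (y + z)) (x * y + x * z)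
                  λ m → ℚ.*-distribˡ-+ (seq x m) (seq y m) (seq z m))
              , (λ x y z → pointwise ((y + z) * x) (y * x + z * x)
                  λ m → ℚ.*-distribʳ-+ (seq x m) (seq y m) (seq z m))
    }
  ; *-comm = λ x y → pointwise (x * y) (y * x) λ m → ℚ.*-comm (seq x m) (seq y m)
  }

+-*-commutativeRing : CommutativeRing 0ℓ 0ℓ
+-*-commutativeRing = record { isCommutativeRing = +-*-isCommutativeRing }

-- Nonnegative reals form a positive cone

0≤-respects-≃ : ∀ x y → x ≃ y → 0ℝ ≤ x → 0ℝ ≤ y
0≤-respects-≃ x y x≃y 0≤x ε 0<ε = both
  (λ {m} x-y<ε/2 0<x+ε/2 → subst (0ℚ ℚ.<_)
    (trans (solve 3 (λ p q h → (q :+ h) :+ h := q :+ (h :+ h)) refl (seq x m) (seq y m) (½ ℚ.* ε))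
      (cong (seq y m ℚ.+_) (half+half ε)))
    (ℚ.<-trans 0<x+ε/2 (ℚ.+-monoˡ-< (½ ℚ.* ε)
      (subst (ℚ._< seq y m ℚ.+ ½ ℚ.* ε)
        (solve 2 (λ p q → q :+ (p :- q) := p) refl (seq x m) (seq y m))
        (ℚ.+-monoʳ-< (seq y m)
          (ℚ.≤-<-trans (p≤∣p∣ (seq x m ℚ.- seq y m)) x-y<ε/2))))))
  (x≃y _ (half-pos 0<ε)) (0≤x _ (half-pos 0<ε))

≤⇒0≤- : ∀ x y → x ≤ y → 0ℝ ≤ y + - x
≤⇒0≤- x y x≤y ε 0<ε = map-eventually
  (λ {m} x<y+ε → subst₂ ℚ._<_ (ℚ.+-inverseˡ (seq x m))
    (solve 3 (λ p q e → :- p :+ (q :+ e) := (q :- p) :+ e) refl (seq x m) (seq y m) ε)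
    (ℚ.+-monoʳ-< (ℚ.- seq x m) x<y+ε))
  (x≤y ε 0<ε)

0<⇒0≤ : ∀ x → 0ℝ < x → 0ℝ ≤ x
0<⇒0≤ x (η , 0<η , 0+η<x) ε 0<ε = map-eventually
  (λ {m} 0+η<x → ℚ.+-mono-<
    (ℚ.<-trans (subst (0ℚ ℚ.<_) (sym (ℚ.+-identityˡ η)) 0<η) 0+η<x) 0<ε)
  0+η<x

0≤1 : 0ℝ ≤ 1ℝ
0≤1 ε 0<ε = 0 , λ _ _ → ℚ.+-mono-< (ℚ.positive⁻¹ 1ℚ) 0<ε

0≤+ : ∀ x y → 0ℝ ≤ x → 0ℝ ≤ y → 0ℝ ≤ x + y
0≤+ x y 0≤x 0≤y ε 0<ε = both
  (λ {m} 0<x 0<y → subst (0ℚ ℚ.<_)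
    (trans (solve 3 (λ p q h → (p :+ h) :+ (q :+ h) := (p :+ q) :+ (h :+ h)) refl
             (seq x m) (seq y m) (½ ℚ.* ε))
      (cong (seq x m ℚ.+ seq y m ℚ.+_) (half+half ε)))
    (ℚ.+-mono-< 0<x 0<y))
  (0≤x _ (half-pos 0<ε)) (0≤y _ (half-pos 0<ε))

-- The sign is decided term by term, on rationals. A negative term of `x` is eventually smaller than
-- `η` in absolute value, and the boundedness of `y * y` keeps the product above `- ε`.
0≤*-square : ∀ x y → 0ℝ ≤ x → 0ℝ ≤ x * (y * y)
0≤*-square x y 0≤x ε 0<ε with bounded (y * y)
... | b , 0<b , yy≤b with shrink ε b 0<ε 0<b
... | η , 0<η , small = both step yy≤b (0≤x η 0<η)
  where
  step : ∀ {m} → ℚ.∣ seq y m ℚ.* seq y m ∣ ℚ.≤ b → 0ℚ ℚ.< seq x m ℚ.+ η →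
         0ℚ ℚ.< seq x m ℚ.* (seq y m ℚ.* seq y m) ℚ.+ ε
  step {m} q≤b 0<p+η with 0ℚ ℚ.≤? seq x m
  ... | yes 0≤p = ℚ.+-mono-≤-< (0≤p*q 0≤p (0≤p*p (seq y m))) 0<ε
  ... | no 0≰p  = -p<q⇒0<p+q (ℚ.≤-<-trans (p≤∣p∣ _)
    (subst (ℚ._< ε)
      (trans (cong ℚ.∣_∣ (ℚ.*-comm (seq y m ℚ.* seq y m) (seq x m))) (sym (ℚ.∣-p∣≡∣p∣ _)))
      (small _ (seq x m) q≤b
        (∣p∣<q (ℚ.<-trans (ℚ.≰⇒> 0≰p) 0<η) (0<p+q⇒-p<q 0<p+η)))))

0≤-pointed : ∀ x → 0ℝ ≤ x → 0ℝ ≤ - x → x ≃ 0ℝ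
0≤-pointed x 0≤x 0≤-x ε 0<ε = both
  (λ {m} 0<x+ε 0<-x+ε → subst (λ p → ℚ.∣ p ∣ ℚ.< ε) (sym (p-0≡p (seq x m)))
    (∣p∣<q (subst (ℚ._< ε) (solve 1 (λ p → :- :- p := p) refl (seq x m)) (0<p+q⇒-p<q 0<-x+ε))
           (0<p+q⇒-p<q 0<x+ε)))
  (0≤x ε 0<ε) (0≤-x ε 0<ε)

0≤-halve : ∀ x → 0ℝ ≤ x + x → 0ℝ ≤ x
-- The tolerance is doubled in advance, so that halving leaves `ε`.
0≤-halve x 0≤x+x ε 0<ε = map-eventually step (0≤x+x (ε ℚ.+ ε) (ℚ.+-mono-< 0<ε 0<ε))
  where
  step : ∀ {m} → 0ℚ ℚ.< (seq x m ℚ.+ seq x m) ℚ.+ (ε ℚ.+ ε) → 0ℚ ℚ.< seq x m ℚ.+ ε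
  step {m} 0<2x+2ε with 0ℚ ℚ.<? seq x m ℚ.+ ε
  ... | yes 0<x+ε = 0<x+ε
  ... | no 0≮x+ε  = contradiction refl (ℚ.<⇒≢ (ℚ.<-≤-trans
    (subst (0ℚ ℚ.<_) (+-interchange (seq x m) ε) 0<2x+2ε)
    (ℚ.+-mono-≤ (ℚ.≮⇒≥ 0≮x+ε) (ℚ.≮⇒≥ 0≮x+ε))))
    where
    +-interchange : ∀ p e → (p ℚ.+ p) ℚ.+ (e ℚ.+ e) ≡ (p ℚ.+ e) ℚ.+ (p ℚ.+ e)
    +-interchange = solve 2 (λ p e → (p :+ p) :+ (e :+ e) := (p :+ e) :+ (p :+ e)) refl

-- With tolerance `ε * ε` for the square, a term of absolute value at least `ε` would have too large
-- a square.
x*x≃0⇒x≃0 : ∀ x → x * x ≃ 0ℝ → x ≃ 0ℝ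
x*x≃0⇒x≃0 x x*x≃0 ε 0<ε = map-eventually step (x*x≃0 (ε ℚ.* ε) (0<p*p 0<ε))
  where
  step : ∀ {m} → ℚ.∣ seq x m ℚ.* seq x m ℚ.- 0ℚ ∣ ℚ.< ε ℚ.* ε → ℚ.∣ seq x m ℚ.- 0ℚ ∣ ℚ.< ε
  step {m} rewrite p-0≡p (seq x m ℚ.* seq x m) | p-0≡p (seq x m)
                 | ℚ.∣p*q∣≡∣p∣*∣q∣ (seq x m) (seq x m) = λ pp<εε → ℚ.≰⇒> λ ε≤p →
    ℚ.<⇒≢ (ℚ.<-≤-trans pp<εε (ℚ.≤-trans
      (ℚ.*-monoˡ-≤-nonNeg ε {{ℚ.nonNegative (ℚ.<⇒≤ 0<ε)}} ε≤p)
      (ℚ.*-monoʳ-≤-nonNeg ℚ.∣ seq x m ∣ {{ℚ.∣-∣-nonNeg (seq x m)}} ε≤p))) refl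

0≤-positiveCone : PositiveCone +-*-commutativeRing 0ℓ
0≤-positiveCone = record
  { NonNegative     = 0ℝ ≤_
  ; respects        = λ {x} {y} → 0≤-respects-≃ x y
  ; 1-nonNegative   = 0≤1
  ; +-closed        = λ {x} {y} → 0≤+ x y
  ; *-square-closed = λ {x} y → 0≤*-square x y
  ; pointed         = λ {x} → 0≤-pointed x
  ; halve           = λ {x} → 0≤-halve x
  ; square-zero     = λ {x} → x*x≃0⇒x≃0 x
  }

open Simplices 0≤-positiveCone using (module Spectrum)
open import Algebra.Properties.Monoid.Sum
  (CommutativeRing.+-monoid +-*-commutativeRing) using (sum-init-last)

-- The weight matrix of a graph

module _ {N} (G : Graph N) where
  open Graph G

  weightOrZero-sym : ∀ i j → weightOrZero i j ≃ weightOrZero j i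
  weightOrZero-sym i j with link? i j | link? j i
  ... | yes ij | yes _  = weight-sym ij
  ... | no _   | no _   = ≃-refl 0ℝ
  ... | yes ij | no ¬ji = contradiction (link-sym ij) ¬ji
  ... | no ¬ij | yes ji = contradiction (link-sym ji) ¬ij

  weightOrZero-nonNegative : ∀ i j → 0ℝ ≤ weightOrZero i j
  weightOrZero-nonNegative i j with link? i j
  ... | yes ij = 0<⇒0≤ (weight i j) (weight-pos ij)
  ... | no _   = λ ε 0<ε → 0 , λ _ _ → subst (0ℚ ℚ.<_) (sym (ℚ.+-identityˡ ε)) 0<ε

  laplacian≃D-W : ∀ i j → laplacian i j ≃ δ i j * degree i + - weightOrZero i j
  laplacian≃D-W i j with i ≟ j | link? i j
  -- Without loops the weight matrix has zero diagonal, so the diagonal of D - W is the degree.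
  ... | yes i≡j | yes ij = contradiction ij (link-irrefl i≡j)
  ... | yes _   | no _   = pointwise (degree i) (1ℝ * degree i + - 0ℝ)
    λ m → sym (trans (ℚ.+-identityʳ _) (ℚ.*-identityˡ (seq (degree i) m)))
  ... | no _    | yes _  = pointwise (- weight i j) (0ℝ * degree i + - weight i j)
    λ m → sym (trans (cong (ℚ._- seq (weight i j) m) (ℚ.*-zeroˡ (seq (degree i) m)))
      (ℚ.+-identityˡ (ℚ.- seq (weight i j) m)))
  ... | no _    | no _   = pointwise 0ℝ (0ℝ * degree i + - 0ℝ)
    λ m → sym (trans (ℚ.+-identityʳ _) (ℚ.*-zeroˡ (seq (degree i) m)))

-- Norms of centroids

module _ {n} (G : Graph (suc n)) (S : Simplex G) where
  open Graph G
  open Simplex S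
  open Spectrum n (suc n) inject₁ (fromℕ n) sum-init-last weightOrZero laplacian
    (laplacian≃D-W G) (weightOrZero-sym G) (weightOrZero-nonNegative G)
    z μ orthonormal eigenvector
    -- `fromℕ n` is the greatest index, hence carries the smallest eigenvalue.
    (λ k → ≤⇒0≤- (μ (fromℕ n)) (μ k) (nonIncreasing (≤fromℕ k)))

  -- The size is a variable `m` so that the complement can be treated with denominator written
  -- through `N ∸ ∣ V ∣`.
  ‖centroid‖² : ∀ V (V≢∅ : Nonempty V) {m} → ∣ V ∣ ≡ m → .{{_ : NonZero (m ^ 2)}} →
    ‖ centroid vertex V V≢∅ ‖² ≃ cut V /ₙ (m ^ 2)
  ‖centroid‖² V V≢∅ refl = ≃-trans
    ‖ centroid vertex V V≢∅ ‖² (cut V * (r * r)) (cut V /ₙ (∣ V ∣ ^ 2))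
    (norm-scaled-sum √μ (λ k → proj₂ (√μ-sqrt k)) V r)
    (*-cong (cut V) (cut V) (r * r) (fromℚ (+ 1 ℚ./ (∣ V ∣ ^ 2)))
      (≃-refl (cut V))
      (pointwise (r * r) (fromℚ (+ 1 ℚ./ (∣ V ∣ ^ 2)))
        λ _ → reciprocal-* ∣ V ∣ (cong (∣ V ∣ ℕ.*_) (sym (ℕ.*-identityʳ ∣ V ∣)))))
    where
    instance
      V≢0 : NonZero ∣ V ∣
      V≢0 = nonempty⇒nonZero V≢∅
    r : ℝ
    r = fromℚ (+ 1 ℚ./ ∣ V ∣)

mainTheorem4 :
    (n : ℕ) → let N = suc n in 2 ≤ₙ N →
    (G : Graph N) → Graph.Connected G →
    (S : Simplex G) →
    (V : Subset N) (V≢∅ : Nonempty V) (V⊂𝒩 : V ⊂ ⊤) →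
    let open Graph G using (cut)
        open Simplex S using (vertex)
        instance
          V²≢0 : NonZero (∣ V ∣ ^ 2)
          V²≢0 = square-nonZero (nonempty⇒nonZero V≢∅)
          [N∸V]²≢0 : NonZero ((N ∸ ∣ V ∣) ^ 2)
          [N∸V]²≢0 = square-nonZero (proper⇒∸-nonZero V⊂𝒩)
    in
      (‖ centroid vertex V V≢∅ ‖² ≃ cut V /ₙ (∣ V ∣ ^ 2))
      ×
      (‖ centroid vertex (∁ V) (proper⇒∁-nonempty V⊂𝒩) ‖² ≃ cut (∁ V) /ₙ ((N ∸ ∣ V ∣) ^ 2))
mainTheorem4 n _ G _ S V V≢∅ V⊂𝒩 =
    ‖centroid‖² G S V V≢∅ refl {{square-nonZero (nonempty⇒nonZero V≢∅)}}
  , ‖centroid‖² G S (∁ V) (proper⇒∁-nonempty V⊂𝒩) (∣∁p∣≡n∸∣p∣ V)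
      {{square-nonZero (proper⇒∸-nonZero V⊂𝒩)}}
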